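{- For every integer $d\ge 0$, the following identities hold: (1) $H_d = \sum_{\delta \in \mathrm{PCom}_{\mathrm{sqf}}(d)} (-1)^{\ell(\delta)}E_\delta$; (2) $E_d = \sum_{\delta \in \mathrm{PCom}_{\mathrm{sqf}}(d)} (-1)^{\ell(\delta)}H_\delta$.
   Context: A composition of $n\ge 0$ is a finite tuple $\alpha=(\alpha_1,\dots,\alpha_k)$ of positive integers with sum $|\alpha|=n$; $\ell(\alpha)=k$; the empty composition is the only composition of $0$. A polycomposition of $n$ is a sequence $\delta=(\alpha^{(1)},\alpha^{(2)},\dots)$ of (possibly empty) compositions with $\sum_{i\ge1} i|\alpha^{(i)}|=n$; write $\delta|^i=\alpha^{(i)}$ and, formally (this is not exponentiation), $\delta=(\alpha^{(1)})^1(\alpha^{(2)})^2\cdots$, omitting empty compositions. Its length is $\ell(\delta)=\sum_i \ell(\delta|^i)$. Each part $d$ of $\delta|^r$ gives a block $d^r$ of $\delta$ (degree $d$, multiplicity $r$). $\mathrm{PCom}_{\mathrm{sqf}}(d)$ is the set of square-free polycompositions of $d$: those of the form $(\alpha)^1$ with $\alpha$ a composition of $d$ (all multiplicities equal to $1$). Let $x_{i,j}$ ($i,j\ge 1$) be indeterminates with $\deg x_{i,j}=i$; all series have rational coefficients. A monomial is square-free if every exponent is at most $1$. For $d\ge 0$: $H_d$ is the sum of all monomials of degree $d$; $E_d$ is the sum over square-free monomials $f$ of degree $d$ of $(-1)^{m(f)}f$, where $m(f)$ is the number of indeterminates in $f$. So $H_0=E_0=1$. For $F\in\{H,E\}$ and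 a block $d^r$, $F_{d^r}$ is obtained from $F_d$ by replacing each $x_{i,j}$ by $x_{i,j}^r$, and for a polycomposition $\delta$, $F_\delta=\prod F_{d^r}$ over all blocks $d^r$ of $\delta$ (counted with repetition; empty product $=1$). -}

module Defs where

open import Data.Bool.Base using (if_then_else_; _∧_)
open import Data.Empty using (⊥)
open import Data.Irrelevant using ([_])
open import Data.List.Base
  using (List; []; _∷_; _++_; map; foldr; length; cartesianProductWith; upTo)
open import Data.List.Membership.Propositional using (_∈_)
open import Data.List.Membership.Propositional.Properties
  using (∈-++⁻; ∈-++⁺ˡ; ∈-++⁺ʳ; ∈-map⁻; ∈-map⁺)
open import Data.List.Relation.Binary.Pointwise as Pointwise using (Pointwise; []; _∷_)
open import Data.List.Relation.Unary.All using (All; []; _∷_; all?)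
open import Data.List.Relation.Unary.Any using (here)
open import Data.List.Relation.Unary.Unique.Propositional using (Unique; []; _∷_)
import Data.List.Relation.Unary.Unique.Propositional.Properties as Unique
import Data.List.Properties as List
open import Data.Nat.Base
  using (ℕ; zero; suc; NonZero; _+_; _*_; _∸_; _/_; _⊓_; _≤_; _<_; z≤n; s≤s)
open import Data.Nat.Divisibility using (_∣_; _∣?_; _∣0)
import Data.Nat.DivMod as ℕ
import Data.Nat.Properties as ℕ
open import Data.Nat.ListAction using (sum)
open import Data.Product.Base using (_×_; _,_; ∃-syntax)
open import Data.Rational.Base as ℚ using (ℚ; 0ℚ; 1ℚ)
open import Algebra.Definitions.RawSemiring ℚ.+-*-rawSemiring using (_^_)
open import Data.Refinement using (Refinement-syntax; value; _,_)
open import Data.Sum.Base using (inj₁; inj₂)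
open import Function.Base using (_∘_)
open import Function.Bundles using (_⇔_; mk⇔; Equivalence)
open import Relation.Binary.PropositionalEquality
  using (_≡_; refl; sym; trans; cong; cong₂; subst; isEquivalence)
open import Relation.Binary.Structures using (IsEquivalence)
open import Relation.Nullary.Decidable using (Dec; does; does-⇔)

ℕ⁺ : Set
ℕ⁺ = [ n ∈ ℕ ∣ NonZero n ]

1+ : ℕ → ℕ⁺
1+ n = suc n , [ _ ]

Composition : Set
Composition = List ℕ⁺

∣_∣ : Composition → ℕ
∣ α ∣ = sum (map value α)

-- The k-th entry of the list (counting from 1) is δ|ᵏ; all later δ|ᵏ
-- are empty.
Polycomposition : Set
Polycomposition = List Composition

size : Polycomposition → ℕ
size = sizeFrom 1
  where
  sizeFrom : ℕ → Polycomposition → ℕ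
  sizeFrom i []      = 0
  sizeFrom i (α ∷ δ) = i * ∣ α ∣ + sizeFrom (suc i) δ

ℓ : Polycomposition → ℕ
ℓ δ = sum (map length δ)

record Block : Set where
  constructor block
  field
    degree       : ℕ⁺
    multiplicity : ℕ⁺

-- Indices are shifted by one: the head of the list holds the parts of
-- multiplicity suc k.
blocksFrom : ℕ → Polycomposition → List Block
blocksFrom k []      = []
blocksFrom k (α ∷ δ) = map (λ d → block d (1+ k)) α ++ blocksFrom (suc k) δ

blocks : Polycomposition → List Block
blocks = blocksFrom 0

-- compositionsFrom k n lists the compositions of suc (k + n) whose first
-- part is at least suc k.
compositionsFrom : ℕ → ℕ → List Composition
compositionsFrom k zero    = (1+ k ∷ []) ∷ []
compositionsFrom k (suc n) =
  map (1+ k ∷_) (compositionsFrom 0 n) ++ compositionsFrom (suc k) n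

compositions : ℕ → List Composition
compositions zero    = [] ∷ []
compositions (suc n) = compositionsFrom 0 n

_¹ : Composition → Polycomposition
α ¹ = α ∷ []

PCom-sqf : ℕ → List Polycomposition
PCom-sqf d = map _¹ (compositions d)

∈-compositionsFrom⁻ : ∀ k n {α} → α ∈ compositionsFrom k n →
                      ∃[ p ] ∃[ β ] (α ≡ p ∷ β × k < value p × ∣ α ∣ ≡ suc (k + n))
∈-compositionsFrom⁻ k zero (here refl) =
  _ , _ , refl , ℕ.≤-refl , refl
∈-compositionsFrom⁻ k (suc n) α∈ with ∈-++⁻ (map (1+ k ∷_) (compositionsFrom 0 n)) α∈
... | inj₁ α∈ˡ with ∈-map⁻ (1+ k ∷_) α∈ˡ
...   | β , β∈ , refl with ∈-compositionsFrom⁻ 0 n β∈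
...     | _ , _ , _ , _ , ∣β∣≡ = _ , β , refl , ℕ.≤-refl , cong (λ s → suc (k + s)) ∣β∣≡
∈-compositionsFrom⁻ k (suc n) α∈ | inj₂ α∈ʳ with ∈-compositionsFrom⁻ (suc k) n α∈ʳ
... | p , β , α≡ , k<p , ∣α∣≡ =
  p , β , α≡ , ℕ.<⇒≤ k<p , trans ∣α∣≡ (cong suc (sym (ℕ.+-suc k n)))

∈-compositionsFrom⁺ : ∀ k n j β → j + ∣ β ∣ ≡ n →
                      ((1+ (k + j)) ∷ β) ∈ compositionsFrom k n
∈-compositionsFrom⁺ k zero zero [] eq
  rewrite ℕ.+-identityʳ k = here refl
∈-compositionsFrom⁺ k zero zero ((zero , [ () ]) ∷ β) eq
∈-compositionsFrom⁺ k (suc n) zero ((zero , [ () ]) ∷ β) eq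
∈-compositionsFrom⁺ k (suc n) zero ((suc j , _) ∷ β) eq
  rewrite ℕ.+-identityʳ k =
  ∈-++⁺ˡ (∈-map⁺ (1+ k ∷_) (∈-compositionsFrom⁺ 0 n j β (ℕ.suc-injective eq)))
∈-compositionsFrom⁺ k (suc n) (suc j) β eq
  rewrite ℕ.+-suc k j =
  ∈-++⁺ʳ (map (1+ k ∷_) (compositionsFrom 0 n))
    (∈-compositionsFrom⁺ (suc k) n j β (ℕ.suc-injective eq))

∈-compositions : ∀ n α → α ∈ compositions n ⇔ ∣ α ∣ ≡ n
∈-compositions n α = mk⇔ (sound n) (complete n α)
  where
  sound : ∀ n {α} → α ∈ compositions n → ∣ α ∣ ≡ n
  sound zero    (here refl) = refl
  sound (suc n) α∈ with ∈-compositionsFrom⁻ 0 n α∈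
  ... | _ , _ , _ , _ , ∣α∣≡ = ∣α∣≡

  complete : ∀ n α → ∣ α ∣ ≡ n → α ∈ compositions n
  complete zero    []                    eq = here refl
  complete n       ((zero  , [ () ]) ∷ α) eq
  complete (suc n) ((suc j , _) ∷ α)     eq =
    ∈-compositionsFrom⁺ 0 n j α (ℕ.suc-injective eq)

compositionsFrom-unique : ∀ k n → Unique (compositionsFrom k n)
compositionsFrom-unique k zero    = [] ∷ []
compositionsFrom-unique k (suc n) =
  Unique.++⁺ (Unique.map⁺ List.∷-injectiveʳ (compositionsFrom-unique 0 n))
             (compositionsFrom-unique (suc k) n)
             λ (α∈ˡ , α∈ʳ) → disjoint α∈ˡ α∈ʳ
  where
  disjoint : ∀ {α} → α ∈ map (1+ k ∷_) (compositionsFrom 0 n) →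
             α ∈ compositionsFrom (suc k) n → ⊥
  disjoint α∈ˡ α∈ʳ with ∈-map⁻ (1+ k ∷_) α∈ˡ | ∈-compositionsFrom⁻ (suc k) n α∈ʳ
  ... | _ , _ , refl | _ , _ , refl , k<k , _ = ℕ.<-irrefl refl k<k

compositions-unique : ∀ n → Unique (compositions n)
compositions-unique zero    = [] ∷ []
compositions-unique (suc n) = compositionsFrom-unique 0 n

∈-PCom-sqf : ∀ d δ → δ ∈ PCom-sqf d ⇔ (∃[ α ] δ ≡ α ¹ × size δ ≡ d)
∈-PCom-sqf d δ = mk⇔ sound complete
  where
  size-¹ : ∀ α → size (α ¹) ≡ ∣ α ∣
  size-¹ α = trans (ℕ.+-identityʳ _) (ℕ.+-identityʳ _)

  sound : δ ∈ PCom-sqf d → ∃[ α ] δ ≡ α ¹ × size δ ≡ d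
  sound δ∈ with ∈-map⁻ _¹ δ∈
  ... | α , α∈ , refl =
    α , refl , trans (size-¹ α) (Equivalence.to (∈-compositions d α) α∈)

  complete : (∃[ α ] δ ≡ α ¹ × size δ ≡ d) → δ ∈ PCom-sqf d
  complete (α , refl , size≡) =
    ∈-map⁺ _¹ (Equivalence.from (∈-compositions d α) (trans (sym (size-¹ α)) size≡))

PCom-sqf-unique : ∀ d → Unique (PCom-sqf d)
PCom-sqf-unique d = Unique.map⁺ List.∷-injectiveˡ (compositions-unique d)

-- Lists stand for finitely supported sequences: entries beyond the end
-- take a default value ε.
at : {A : Set} → A → List A → ℕ → A
at ε []       k       = ε
at ε (x ∷ xs) zero    = x
at ε (x ∷ xs) (suc k) = at ε xs k

Row : Set
Row = List ℕ

-- Row i of the list, position j of the row (both counting from 0) holds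
-- the exponent of x_{i+1,j+1}; missing exponents are 0.
Monomial : Set
Monomial = List Row

exponent : Monomial → ℕ → ℕ → ℕ
exponent m i j = at 0 (at [] m i) j

infix 4 _≈ʳ_ _≈ᵐ_

_≈ʳ_ : Row → Row → Set
r ≈ʳ s = ∀ j → at 0 r j ≡ at 0 s j

-- A monomial is determined by its exponents, not by the list storing them.
_≈ᵐ_ : Monomial → Monomial → Set
m ≈ᵐ n = ∀ i j → exponent m i j ≡ exponent n i j

-- Σₖ w k xsₖ, for k counting from 0.
total : {A : Set} → (ℕ → A → ℕ) → List A → ℕ
total w []       = 0
total w (x ∷ xs) = w 0 x + total (w ∘ suc) xs

degree : Monomial → ℕ
degree = total λ i r → suc i * total (λ _ e → e) r

-- The summand e ⊓ 1 is 1 if the exponent e is positive, and 0 otherwise.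
indeterminates : Monomial → ℕ
indeterminates = total λ _ r → total (λ _ e → e ⊓ 1) r

SquareFree : Monomial → Set
SquareFree = All (All (_≤ 1))

squareFree? : ∀ m → Dec (SquareFree m)
squareFree? = all? (all? (ℕ._≤? 1))

IsPower : ℕ → Monomial → Set
IsPower r = All (All (r ∣_))

isPower? : ∀ r m → Dec (IsPower r m)
isPower? r = all? (all? (r ∣?_))

root : (r : ℕ) .{{_ : NonZero r}} → Monomial → Monomial
root r = map (map (_/ r))

-- Each ordered factorisation of a monomial is listed once, because an
-- entry missing from the table, like an explicit 0, splits only as (0 , 0).
splits : ℕ → List (ℕ × ℕ)
splits e = map (λ a → a , e ∸ a) (upTo (suc e))

entrywise : {A : Set} → (A → List (A × A)) → List A → List (List A × List A)
entrywise s []       = ([] , []) ∷ []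
entrywise s (x ∷ xs) =
  cartesianProductWith (λ (a , b) (as , bs) → a ∷ as , b ∷ bs) (s x) (entrywise s xs)

factorisations : Monomial → List (Monomial × Monomial)
factorisations = entrywise (entrywise splits)

module PaddedProperties {A : Set} (ε : A) (_~_ : A → A → Set)
                        (~-isEquivalence : IsEquivalence _~_) where
  open IsEquivalence ~-isEquivalence
    using () renaming (refl to ~-refl; sym to ~-sym; trans to ~-trans)

  infix 4 _≋_
  _≋_ : List A → List A → Set
  xs ≋ ys = ∀ k → at ε xs k ~ at ε ys k

  ≋-isEquivalence : IsEquivalence _≋_
  ≋-isEquivalence = record
    { refl  = λ k → ~-refl
    ; sym   = λ eq k → ~-sym (eq k)
    ; trans = λ eq eq′ k → ~-trans (eq k) (eq′ k)
    }

  ∷-cong : ∀ {x y xs ys} → x ~ y → xs ≋ ys → x ∷ xs ≋ y ∷ ys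
  ∷-cong x~y xs≋ys zero    = x~y
  ∷-cong x~y xs≋ys (suc k) = xs≋ys k

  ε∷[] : ε ∷ [] ≋ []
  ε∷[] zero    = ~-refl
  ε∷[] (suc k) = ~-refl

  total-cong : (w : ℕ → A → ℕ) → (∀ k → w k ε ≡ 0) →
               (∀ k {x y} → x ~ y → w k x ≡ w k y) →
               ∀ xs ys → xs ≋ ys → total w xs ≡ total w ys
  total-cong w wε w~ []       []       eq = refl
  total-cong w wε w~ []       (y ∷ ys) eq =
    cong₂ _+_ (trans (sym (wε 0)) (w~ 0 (eq 0)))
              (total-cong (w ∘ suc) (wε ∘ suc) (w~ ∘ suc) [] ys (eq ∘ suc))
  total-cong w wε w~ (x ∷ xs) []       eq =
    cong₂ _+_ (trans (w~ 0 (eq 0)) (wε 0))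
              (total-cong (w ∘ suc) (wε ∘ suc) (w~ ∘ suc) xs [] (eq ∘ suc))
  total-cong w wε w~ (x ∷ xs) (y ∷ ys) eq =
    cong₂ _+_ (w~ 0 (eq 0))
              (total-cong (w ∘ suc) (wε ∘ suc) (w~ ∘ suc) xs ys (eq ∘ suc))

  All-resp : {P : A → Set} → P ε → (∀ {x y} → x ~ y → P x → P y) →
             ∀ xs ys → xs ≋ ys → All P xs → All P ys
  All-resp Pε P~ xs       []       eq _          = []
  All-resp Pε P~ []       (y ∷ ys) eq []         =
    P~ (eq 0) Pε ∷ All-resp Pε P~ [] ys (eq ∘ suc) []
  All-resp Pε P~ (x ∷ xs) (y ∷ ys) eq (px ∷ pxs) =
    P~ (eq 0) px ∷ All-resp Pε P~ xs ys (eq ∘ suc) pxs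

  at-map : (f : A → A) → f ε ~ ε → ∀ xs k → at ε (map f xs) k ~ f (at ε xs k)
  at-map f fε []       k       = ~-sym fε
  at-map f fε (x ∷ xs) zero    = ~-refl
  at-map f fε (x ∷ xs) (suc k) = at-map f fε xs k

  map-cong : (f : A → A) → f ε ~ ε → (∀ {x y} → x ~ y → f x ~ f y) →
             ∀ xs ys → xs ≋ ys → map f xs ≋ map f ys
  map-cong f fε f~ xs ys eq k =
    ~-trans (at-map f fε xs k) (~-trans (f~ (eq k)) (~-sym (at-map f fε ys k)))

  module Entrywise
    (s : A → List (A × A)) (s-ε : s ε ≡ (ε , ε) ∷ [])
    (s-cong : ∀ x y → x ~ y → Pointwise (λ (a , b) (c , d) → a ~ c × b ~ d) (s x) (s y))
    where

    _~²_ : A × A → A × A → Set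
    (a , b) ~² (c , d) = a ~ c × b ~ d

    _≋²_ : List A × List A → List A × List A → Set
    (as , bs) ≋² (cs , ds) = as ≋ cs × bs ≋ ds

    cons : A × A → List A × List A → List A × List A
    cons (a , b) (as , bs) = a ∷ as , b ∷ bs

    product-cong : ∀ {ps qs xss yss} → Pointwise _~²_ ps qs → Pointwise _≋²_ xss yss →
                   Pointwise _≋²_ (cartesianProductWith cons ps xss)
                                  (cartesianProductWith cons qs yss)
    product-cong []                         eqs = []
    product-cong ((a~c , b~d) ∷ ps~qs) eqs =
      Pointwise.++⁺ (heads eqs) (product-cong ps~qs eqs)
      where
      heads : ∀ {xss yss} → Pointwise _≋²_ xss yss →
              Pointwise _≋²_ (map (cons _) xss) (map (cons _) yss)
      heads []                   = []
      heads ((as≋ , bs≋) ∷ eqs′) = (∷-cong a~c as≋ , ∷-cong b~d bs≋) ∷ heads eqs′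

    ≋²-sym : ∀ {p q} → p ≋² q → q ≋² p
    ≋²-sym (e₁ , e₂) = ~-sym ∘ e₁ , ~-sym ∘ e₂

    ≋²-trans : ∀ {p q r} → p ≋² q → q ≋² r → p ≋² r
    ≋²-trans (e₁ , e₂) (f₁ , f₂) =
      (λ k → ~-trans (e₁ k) (f₁ k)) , (λ k → ~-trans (e₂ k) (f₂ k))

    []-cong : ∀ ys → [] ≋ ys → Pointwise _≋²_ (entrywise s []) (entrywise s ys)
    []-cong []       eq = ((λ k → ~-refl) , (λ k → ~-refl)) ∷ []
    []-cong (y ∷ ys) eq =
      Pointwise.transitive {R = _≋²_} {S = _≋²_} {T = _≋²_}
        (λ {p} {q} {r} → ≋²-trans {p} {q} {r})
        ((~-sym ∘ ε∷[] , ~-sym ∘ ε∷[]) ∷ [])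
        (product-cong (subst (λ ps → Pointwise _~²_ ps (s y)) s-ε (s-cong ε y (eq 0)))
                      ([]-cong ys (eq ∘ suc)))

    entrywise-cong : ∀ xs ys → xs ≋ ys → Pointwise _≋²_ (entrywise s xs) (entrywise s ys)
    entrywise-cong []       ys       eq = []-cong ys eq
    entrywise-cong (x ∷ xs) []       eq =
      Pointwise.symmetric {R = _≋²_} {S = _≋²_} (λ {p} {q} → ≋²-sym {p} {q})
        ([]-cong (x ∷ xs) (~-sym ∘ eq))
    entrywise-cong (x ∷ xs) (y ∷ ys) eq =
      product-cong (s-cong x y (eq 0)) (entrywise-cong xs ys (eq ∘ suc))

module Rows      = PaddedProperties 0 _≡_ isEquivalence
module Monomials = PaddedProperties [] _≈ʳ_ Rows.≋-isEquivalence

degree-cong : ∀ m n → m ≈ᵐ n → degree m ≡ degree n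
degree-cong =
  Monomials.total-cong _ (λ i → ℕ.*-zeroʳ (suc i)) λ i {r} {s} r≈s →
    cong (suc i *_) (Rows.total-cong _ (λ _ → refl) (λ _ e≡ → e≡) r s r≈s)

indeterminates-cong : ∀ m n → m ≈ᵐ n → indeterminates m ≡ indeterminates n
indeterminates-cong =
  Monomials.total-cong _ (λ _ → refl) λ _ {r} {s} →
    Rows.total-cong _ (λ _ → refl) (λ _ → cong (_⊓ 1)) r s

All²-resp : {P : ℕ → Set} → P 0 → ∀ m n → m ≈ᵐ n → All (All P) m → All (All P) n
All²-resp P0 = Monomials.All-resp [] λ {r} {s} →
  Rows.All-resp P0 (λ { refl p → p }) r s

All²-⇔ : {P : ℕ → Set} → P 0 → ∀ m n → m ≈ᵐ n → All (All P) m ⇔ All (All P) n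
All²-⇔ P0 m n m≈n =
  mk⇔ (All²-resp P0 m n m≈n) (All²-resp P0 n m λ i j → sym (m≈n i j))

root-cong : ∀ r .{{_ : NonZero r}} m n → m ≈ᵐ n → root r m ≈ᵐ root r n
root-cong r = Monomials.map-cong (map (_/ r)) (λ _ → refl) λ {s} {t} →
  Rows.map-cong (_/ r) (ℕ.0/n≡0 r) (cong (_/ r)) s t

factorisations-cong : ∀ m n → m ≈ᵐ n →
  Pointwise (λ (a , b) (c , d) → a ≈ᵐ c × b ≈ᵐ d) (factorisations m) (factorisations n)
factorisations-cong =
  Monomials.Entrywise.entrywise-cong (entrywise splits) refl
    (Rows.Entrywise.entrywise-cong splits refl
      λ { x .x refl → Pointwise.refl (refl , refl) })

record Series : Set where
  field
    coefficient      : Monomial → ℚ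
    coefficient-cong : ∀ m n → m ≈ᵐ n → coefficient m ≡ coefficient n

open Series public

infix  4 _≈_
infixl 6 _⊕_
infixl 7 _⊛_
infixr 8 _·_

_≈_ : Series → Series → Set
F ≈ G = ∀ m → coefficient F m ≡ coefficient G m

𝟘 : Series
𝟘 = record { coefficient = λ _ → 0ℚ ; coefficient-cong = λ _ _ _ → refl }

-- Every indeterminate has positive degree, so 1 is the only monomial of
-- degree 0.
𝟙 : Series
𝟙 = record
  { coefficient      = λ m → if does (degree m ℕ.≟ 0) then 1ℚ else 0ℚ
  ; coefficient-cong = λ m n m≈n →
      cong (λ k → if does (k ℕ.≟ 0) then 1ℚ else 0ℚ) (degree-cong m n m≈n)
  }

_⊕_ : Series → Series → Series
F ⊕ G = record
  { coefficient      = λ m → coefficient F m ℚ.+ coefficient G m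
  ; coefficient-cong = λ m n m≈n →
      cong₂ ℚ._+_ (coefficient-cong F m n m≈n) (coefficient-cong G m n m≈n)
  }

_·_ : ℚ → Series → Series
c · F = record
  { coefficient      = λ m → c ℚ.* coefficient F m
  ; coefficient-cong = λ m n m≈n → cong (c ℚ.*_) (coefficient-cong F m n m≈n)
  }

sumℚ : List ℚ → ℚ
sumℚ = foldr ℚ._+_ 0ℚ

_⊛_ : Series → Series → Series
F ⊛ G = record
  { coefficient      = λ m → sumℚ (map term (factorisations m))
  ; coefficient-cong = λ m n m≈n → sum-cong (factorisations-cong m n m≈n)
  }
  where
  term : Monomial × Monomial → ℚ
  term (a , b) = coefficient F a ℚ.* coefficient G b

  sum-cong : ∀ {ps qs} → Pointwise (λ (a , b) (c , d) → a ≈ᵐ c × b ≈ᵐ d) ps qs →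
             sumℚ (map term ps) ≡ sumℚ (map term qs)
  sum-cong []                  = refl
  sum-cong ((a≈c , b≈d) ∷ eqs) =
    cong₂ ℚ._+_ (cong₂ ℚ._*_ (coefficient-cong F _ _ a≈c) (coefficient-cong G _ _ b≈d))
                (sum-cong eqs)

∑ : List Series → Series
∑ = foldr _⊕_ 𝟘

∏ : List Series → Series
∏ = foldr _⊛_ 𝟙

-- F with every indeterminate x replaced by xʳ.
powers : Series → ℕ⁺ → Series
powers F (r , [ r≢0 ]) = record
  { coefficient      = λ m → if does (isPower? r m)
                               then coefficient F (rootʳ m) else 0ℚ
  ; coefficient-cong = λ m n m≈n →
      cong₂ (λ b c → if b then c else 0ℚ)
        (does-⇔ (All²-⇔ (r ∣0) m n m≈n) (isPower? r m) (isPower? r n))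
        (coefficient-cong F _ _ (root-cong r {{r≢0}} m n m≈n))
  }
  where
  rootʳ : Monomial → Monomial
  rootʳ = root r {{r≢0}}

-1^_ : ℕ → ℚ
-1^ n = (ℚ.- 1ℚ) ^ n

H : ℕ → Series
H d = record
  { coefficient      = λ m → if does (degree m ℕ.≟ d) then 1ℚ else 0ℚ
  ; coefficient-cong = λ m n m≈n →
      cong (λ k → if does (k ℕ.≟ d) then 1ℚ else 0ℚ) (degree-cong m n m≈n)
  }

E : ℕ → Series
E d = record
  { coefficient      = λ m → if does (degree m ℕ.≟ d) ∧ does (squareFree? m)
                               then -1^ indeterminates m else 0ℚ
  ; coefficient-cong = λ m n m≈n →
      cong₂ (λ b k → if b then -1^ k else 0ℚ)
        (cong₂ _∧_ (cong (λ k → does (k ℕ.≟ d)) (degree-cong m n m≈n))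
                   (does-⇔ (All²-⇔ z≤n m n m≈n) (squareFree? m) (squareFree? n)))
        (indeterminates-cong m n m≈n)
  }

-- F_δ, where F_{dʳ} is F_d with every indeterminate replaced by its r-th power.
_⟨_⟩ : (ℕ → Series) → Polycomposition → Series
F ⟨ δ ⟩ = ∏ (map (λ (block d r) → powers (F (value d)) r) (blocks δ))

{-# OPTIONS --safe #-}

-- Both H_d and E_d have the shape Σ_{deg m = d} ∏ₑ w(e) m, the product being
-- over the exponents e of m, for the weights w = 1 and w = (1, -1, 0, 0, …).
-- Multiplying series of this shape convolves the weights, and these two
-- weights are inverse to each other, so Σ_{i+j=d} E_i H_j = 0 for d > 0, and
-- likewise with E and H exchanged.  The signed sum over compositions satisfies
-- the same recursion, obtained by splitting off the first part.

module Submission where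

open import Defs
open import Algebra.Properties.Semiring.Exp using (^-homo-*)
open import Algebra.Bundles using (CommutativeRing)
open import Data.Bool.Base using (Bool; true; false; if_then_else_)
open import Data.List.Base
  using (List; []; _∷_; _++_; map; foldr; applyUpTo; cartesianProductWith)
open import Data.List.Properties using (map-∘; map-cong; map-++; map-upTo; map-applyUpTo)
open import Data.List.Relation.Unary.All as All using (All; []; _∷_; all?)
import Data.List.Relation.Unary.All.Properties as All
open import Data.Nat.Base as ℕ using (ℕ; zero; suc; _≡ᵇ_; _⊓_; _∸_; _≤_; z≤n; s≤s)
open import Data.Nat.Divisibility using (1∣_)
open import Data.Nat.DivMod using (n/1≡n)
import Data.Nat.Properties as ℕ
open import Data.Product.Base using (_×_; _,_)
open import Data.Rational.Base using (ℚ; 0ℚ; 1ℚ; _+_; _*_; -_)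
open import Data.Rational.Properties
open import Data.Rational.Solver using (module +-*-Solver)
open import Function.Base using (_∘_)
open import Relation.Binary.PropositionalEquality
open import Relation.Nullary.Decidable using (does; dec-true)
open import Relation.Unary using (Decidable)
open import Algebra.Properties.CommutativeSemigroup ℕ.+-commutativeSemigroup
  using () renaming (interchange to +-interchange)

open +-*-Solver using (solve; _:+_; _:*_; :-_; con; _:=_)
open ≡-Reasoning

private variable
  A B C : Set

-- Finite sums and products of rationals

sumOver : (A → ℚ) → List A → ℚ
sumOver f = sumℚ ∘ map f

sumOver-congᴬ : {f g : A → ℚ} {xs : List A} →
                All (λ x → f x ≡ g x) xs → sumOver f xs ≡ sumOver g xs
sumOver-congᴬ []         = refl
sumOver-congᴬ (eq ∷ eqs) = cong₂ _+_ eq (sumOver-congᴬ eqs)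

sumOver-cong : {f g : A → ℚ} → (∀ x → f x ≡ g x) → ∀ xs → sumOver f xs ≡ sumOver g xs
sumOver-cong eq xs = cong sumℚ (map-cong eq xs)

sumℚ-++ : ∀ xs ys → sumℚ (xs ++ ys) ≡ sumℚ xs + sumℚ ys
sumℚ-++ []       ys = sym (+-identityˡ _)
sumℚ-++ (x ∷ xs) ys = trans (cong (x +_) (sumℚ-++ xs ys)) (sym (+-assoc x _ _))

sumOver-+ : (f g : A → ℚ) → ∀ xs →
            sumOver (λ x → f x + g x) xs ≡ sumOver f xs + sumOver g xs
sumOver-+ f g []       = refl
sumOver-+ f g (x ∷ xs) = trans (cong (f x + g x +_) (sumOver-+ f g xs))
  (solve 4 (λ a b c d → (a :+ b) :+ (c :+ d) := (a :+ c) :+ (b :+ d)) refl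
    (f x) (g x) (sumOver f xs) (sumOver g xs))

sumOver-* : (c : ℚ) (f : A → ℚ) → ∀ xs → sumOver (λ x → c * f x) xs ≡ c * sumOver f xs
sumOver-* c f []       = sym (*-zeroʳ c)
sumOver-* c f (x ∷ xs) = trans
  (cong (c * f x +_) (sumOver-* c f xs))
  (sym (*-distribˡ-+ c (f x) (sumOver f xs)))

sumOver-0 : ∀ (xs : List A) → sumOver (λ _ → 0ℚ) xs ≡ 0ℚ
sumOver-0 []       = refl
sumOver-0 (_ ∷ xs) = trans (+-identityˡ _) (sumOver-0 xs)

sumOver-cartesianProductWith :
  (c : A → B → C) {f : A → ℚ} {g : B → ℚ} {h : C → ℚ} →
  (∀ x y → h (c x y) ≡ f x * g y) → ∀ xs ys →
  sumOver h (cartesianProductWith c xs ys) ≡ sumOver f xs * sumOver g ys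
sumOver-cartesianProductWith c eq [] ys = sym (*-zeroˡ (sumOver _ ys))
sumOver-cartesianProductWith c {f} {g} {h} eq (x ∷ xs) ys = begin
  sumℚ (map h (map (c x) ys ++ rest))
    ≡⟨ cong sumℚ (map-++ h (map (c x) ys) rest) ⟩
  sumℚ (map h (map (c x) ys) ++ map h rest)
    ≡⟨ sumℚ-++ (map h (map (c x) ys)) (map h rest) ⟩
  sumOver h (map (c x) ys) + sumOver h rest
    ≡⟨ cong₂ _+_
         (trans (cong sumℚ (sym (map-∘ ys)))
           (trans (sumOver-cong (eq x) ys) (sumOver-* (f x) g ys)))
         (sumOver-cartesianProductWith c eq xs ys) ⟩
  f x * sumOver g ys + sumOver f xs * sumOver g ys
    ≡⟨ *-distribʳ-+ (sumOver g ys) (f x) (sumOver f xs) ⟨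
  (f x + sumOver f xs) * sumOver g ys ∎
  where rest = cartesianProductWith c xs ys

sumℚ-applyUpTo-0 : ∀ {f} → (∀ i → f i ≡ 0ℚ) → ∀ n → sumℚ (applyUpTo f n) ≡ 0ℚ
sumℚ-applyUpTo-0 eq zero    = refl
sumℚ-applyUpTo-0 eq (suc n) = cong₂ _+_ (eq 0) (sumℚ-applyUpTo-0 (eq ∘ suc) n)

productOver : (A → ℚ) → List A → ℚ
productOver f = foldr (λ x q → f x * q) 1ℚ

productOver-cong : {f g : A → ℚ} → (∀ x → f x ≡ g x) →
                   ∀ xs → productOver f xs ≡ productOver g xs
productOver-cong eq []       = refl
productOver-cong eq (x ∷ xs) = cong₂ _*_ (eq x) (productOver-cong eq xs)

productOver-1 : {f : A → ℚ} → (∀ x → f x ≡ 1ℚ) → ∀ xs → productOver f xs ≡ 1ℚ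
productOver-1 eq []       = refl
productOver-1 eq (x ∷ xs) = cong₂ _*_ (eq x) (productOver-1 eq xs)

-- Weights of monomials and their convolution

indicator : Bool → ℚ
indicator b = if b then 1ℚ else 0ℚ

indicator-+-≡ᵇ0 : ∀ p q → indicator (p ℕ.+ q ≡ᵇ 0) ≡ indicator (p ≡ᵇ 0) * indicator (q ≡ᵇ 0)
indicator-+-≡ᵇ0 zero    q = sym (*-identityˡ _)
indicator-+-≡ᵇ0 (suc p) q = sym (*-zeroˡ (indicator (q ≡ᵇ 0)))

-- The series with these coefficients is the degree d part of a product over
-- all indeterminates x of Σₑ w(e) xᵉ.
weight : (ℕ → ℚ) → Monomial → ℚ
weight w = productOver (productOver w)

weight-cong : ∀ {v w} → (∀ e → v e ≡ w e) → ∀ m → weight v m ≡ weight w m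
weight-cong eq = productOver-cong (productOver-cong eq)

infixl 7 _⋆_
_⋆_ : (ℕ → ℚ) → (ℕ → ℚ) → ℕ → ℚ
(v ⋆ w) e = sumOver (λ (a , b) → v a * w b) (splits e)

⋆-applyUpTo : ∀ v w e → (v ⋆ w) e ≡ sumℚ (applyUpTo (λ a → v a * w (e ∸ a)) (suc e))
⋆-applyUpTo v w e = cong sumℚ
  (trans (cong (map λ (a , b) → v a * w b) (map-upTo (λ a → a , e ∸ a) (suc e)))
         (map-applyUpTo (λ a → a , e ∸ a) (λ (a , b) → v a * w b) (suc e)))

-- A list is split by splitting each entry independently, so by distributivity the sum over all its
-- splittings factors into one sum per entry.
sumOver-entrywise :
  (s : A → List (A × A)) (f g : A → ℚ) → ∀ xs →
  sumOver (λ (as , bs) → productOver f as * productOver g bs) (entrywise s xs) ≡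
  productOver (λ x → sumOver (λ (a , b) → f a * g b) (s x)) xs
sumOver-entrywise s f g []       = refl
sumOver-entrywise s f g (x ∷ xs) = trans
  (sumOver-cartesianProductWith _
    {λ (a , b) → f a * g b} {λ (as , bs) → productOver f as * productOver g bs}
    (λ (a , b) (as , bs) →
      solve 4 (λ a p b q → (a :* p) :* (b :* q) := (a :* b) :* (p :* q)) refl
        (f a) (productOver f as) (g b) (productOver g bs))
    (s x) (entrywise s xs))
  (cong (sumOver (λ (a , b) → f a * g b) (s x) *_) (sumOver-entrywise s f g xs))

-- The factorisation of sums is applied twice, first to the rows of the table and then to the
-- exponents within a row.
weight-⋆ : ∀ v w m →
  sumOver (λ (a , b) → weight v a * weight w b) (factorisations m) ≡ weight (v ⋆ w) m
weight-⋆ v w m = trans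
  (sumOver-entrywise (entrywise splits) (productOver v) (productOver w) m)
  (productOver-cong (sumOver-entrywise splits v w) m)

-- Additivity of the degree under factorisation

total-entrywise :
  (s : A → List (A × A)) (w : ℕ → A → ℕ) →
  (∀ i x → All (λ (a , b) → w i a ℕ.+ w i b ≡ w i x) (s x)) → ∀ xs →
  All (λ (as , bs) → total w as ℕ.+ total w bs ≡ total w xs) (entrywise s xs)
total-entrywise s w eq []       = refl ∷ []
total-entrywise s w eq (x ∷ xs) =
  All.cartesianProductWith⁺ (setoid _) (setoid _) _ (s x) (entrywise s xs)
    λ {(a , b)} {(as , bs)} p∈ q∈ → trans
      (+-interchange (w 0 a) (total (w ∘ suc) as) (w 0 b) (total (w ∘ suc) bs))
      (cong₂ ℕ._+_ (All.lookup (eq 0 x) p∈)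
        (All.lookup (total-entrywise s (w ∘ suc) (eq ∘ suc) xs) q∈))

degree-factorisations : ∀ m →
  All (λ (a , b) → degree a ℕ.+ degree b ≡ degree m) (factorisations m)
degree-factorisations = total-entrywise (entrywise splits) _ λ i r →
  All.map
    (λ {(a , b)} eq → trans
      (sym (ℕ.*-distribˡ-+ (suc i) (total (λ _ e → e) a) (total (λ _ e → e) b)))
      (cong (suc i ℕ.*_) eq))
    (total-entrywise splits (λ _ e → e)
      -- A split of `e` is `(a , e ∸ a)` with `a ≤ e`, so the truncated subtraction is exact.
      (λ _ e → All.map⁺ (All.applyUpTo⁺₁ (λ a → a) (suc e) (ℕ.m+[n∸m]≡n ∘ ℕ.≤-pred))) r)

-- Degrees of the two factors always add up to `degree m`, so the indicator is constant along the
-- sum and can be pulled out.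
sumOver-factorisations : ∀ v w n m →
  sumOver (λ (a , b) → indicator (degree a ℕ.+ degree b ≡ᵇ n) * (weight v a * weight w b))
          (factorisations m) ≡
  indicator (degree m ≡ᵇ n) * weight (v ⋆ w) m
sumOver-factorisations v w n m = begin
  _ ≡⟨ sumOver-congᴬ (All.map
         (λ {(a , b)} eq →
           cong (λ k → indicator (k ≡ᵇ n) * (weight v a * weight w b)) eq)
         (degree-factorisations m)) ⟩
  sumOver (λ (a , b) → indicator (degree m ≡ᵇ n) * (weight v a * weight w b))
          (factorisations m)
    ≡⟨ sumOver-* (indicator (degree m ≡ᵇ n)) _ (factorisations m) ⟩
  indicator (degree m ≡ᵇ n) *
    sumOver (λ (a , b) → weight v a * weight w b) (factorisations m)
    ≡⟨ cong (indicator (degree m ≡ᵇ n) *_) (weight-⋆ v w m) ⟩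
  indicator (degree m ≡ᵇ n) * weight (v ⋆ w) m ∎

-- The unit for convolution and the degree 0 part

δ₀ : ℕ → ℚ
δ₀ e = indicator (e ≡ᵇ 0)

δ₀-⋆ : ∀ w e → (δ₀ ⋆ w) e ≡ w e
δ₀-⋆ w e = trans (⋆-applyUpTo δ₀ w e)
  (trans (cong (1ℚ * w e +_) (sumℚ-applyUpTo-0 (λ i → *-zeroˡ (w (e ∸ suc i))) e))
         (trans (+-identityʳ (1ℚ * w e)) (*-identityˡ (w e))))

-- A sum of natural numbers vanishes exactly when every summand does, so its indicator is a product
-- of indicators that can be absorbed factor by factor.
total-zero : (w : ℕ → A → ℕ) {f g : A → ℚ} →
  (∀ i x → indicator (w i x ≡ᵇ 0) * f x ≡ g x) → ∀ xs →
  indicator (total w xs ≡ᵇ 0) * productOver f xs ≡ productOver g xs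
total-zero w eq []       = refl
total-zero w {f} {g} eq (x ∷ xs) = begin
  indicator (w 0 x ℕ.+ total (w ∘ suc) xs ≡ᵇ 0) * (f x * productOver f xs)
    ≡⟨ cong (_* (f x * productOver f xs)) (indicator-+-≡ᵇ0 (w 0 x) _) ⟩
  (indicator (w 0 x ≡ᵇ 0) * indicator (total (w ∘ suc) xs ≡ᵇ 0)) * (f x * productOver f xs)
    ≡⟨ solve 4 (λ i j y z → (i :* j) :* (y :* z) := (i :* y) :* (j :* z)) refl
         (indicator (w 0 x ≡ᵇ 0)) _ (f x) _ ⟩
  (indicator (w 0 x ≡ᵇ 0) * f x) * (indicator (total (w ∘ suc) xs ≡ᵇ 0) * productOver f xs)
    ≡⟨ cong₂ _*_ (eq 0 x) (total-zero (w ∘ suc) (eq ∘ suc) xs) ⟩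
  g x * productOver g xs ∎

suc*-≡ᵇ0 : ∀ i n → (suc i ℕ.* n ≡ᵇ 0) ≡ (n ≡ᵇ 0)
suc*-≡ᵇ0 i zero    = cong (_≡ᵇ 0) (ℕ.*-zeroʳ i)
suc*-≡ᵇ0 i (suc n) = refl

-- In degree 0 every exponent is 0 and contributes `w 0 = 1`; in positive degree some exponent is
-- positive, and there `δ₀` vanishes.
weight-degree-0 : ∀ {w} → w 0 ≡ 1ℚ → ∀ m →
                  indicator (degree m ≡ᵇ 0) * weight w m ≡ weight δ₀ m
weight-degree-0 {w} w0≡1 = total-zero _ λ i r → trans
  -- Row `i` enters the degree with the nonzero factor `suc i`, which does not affect vanishing.
  (cong (λ b → indicator b * productOver w r) (suc*-≡ᵇ0 i (total (λ _ e → e) r)))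
  (total-zero (λ _ e → e) entry r)
  where
  entry : ∀ (_ : ℕ) e → δ₀ e * w e ≡ δ₀ e
  entry _ zero    = trans (*-identityˡ _) w0≡1
  entry _ (suc e) = *-zeroˡ (w (suc e))

weight-1 : ∀ m → weight (λ _ → 1ℚ) m ≡ 1ℚ
weight-1 = productOver-1 (productOver-1 λ _ → refl)

weight-δ₀ : ∀ m → weight δ₀ m ≡ indicator (degree m ≡ᵇ 0)
weight-δ₀ m = begin
  weight δ₀ m
    -- The constant weight 1 is chosen because its product over any monomial is 1, leaving the bare
    -- indicator.
    ≡⟨ weight-degree-0 {λ _ → 1ℚ} refl m ⟨
  indicator (degree m ≡ᵇ 0) * weight (λ _ → 1ℚ) m
    ≡⟨ cong (indicator (degree m ≡ᵇ 0) *_) (weight-1 m) ⟩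
  indicator (degree m ≡ᵇ 0) * 1ℚ
    ≡⟨ *-identityʳ _ ⟩
  indicator (degree m ≡ᵇ 0) ∎

-- Linearity of the product of series, and blocks of multiplicity 1

coefficient-⊛ : ∀ F G m → coefficient (F ⊛ G) m ≡
  sumOver (λ (a , b) → coefficient F a * coefficient G b) (factorisations m)
coefficient-⊛ F G m = cong sumℚ (map-cong (λ _ → refl) (factorisations m))

⊛-cong : ∀ F F′ G G′ → F ≈ F′ → G ≈ G′ → F ⊛ G ≈ F′ ⊛ G′
⊛-cong F F′ G G′ F≈ G≈ m =
  cong sumℚ (map-cong (λ (a , b) → cong₂ _*_ (F≈ a) (G≈ b)) (factorisations m))

⊛-distribˡ-⊕ : ∀ F G K → F ⊛ (G ⊕ K) ≈ (F ⊛ G) ⊕ (F ⊛ K)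
⊛-distribˡ-⊕ F G K m = trans
  (sumOver-cong (λ (a , b) → *-distribˡ-+ (coefficient F a) _ _) (factorisations m))
  (sumOver-+ _ _ (factorisations m))

⊛-· : ∀ c F G → F ⊛ (c · G) ≈ c · (F ⊛ G)
⊛-· c F G m = trans
  (sumOver-cong (λ (a , b) → solve 3 (λ c f g → f :* (c :* g) := c :* (f :* g)) refl
                               c (coefficient F a) (coefficient G b))
                (factorisations m))
  (sumOver-* c _ (factorisations m))

⊛-zeroʳ : ∀ F → F ⊛ 𝟘 ≈ 𝟘
⊛-zeroʳ F m = trans (sumOver-cong (λ (a , b) → *-zeroʳ (coefficient F a)) (factorisations m))
                    (sumOver-0 (factorisations m))

root-1 : ∀ m → root 1 m ≈ᵐ m
root-1 m i j = trans
  (Monomials.at-map (map (ℕ._/ 1)) (λ _ → refl) m i j)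
  (trans (Rows.at-map (ℕ._/ 1) refl (at [] m i) j) (n/1≡n _))

-- All blocks of a square-free polycomposition have multiplicity 1, so this removes the substitution
-- of powers from every `F ⟨ α ¹ ⟩`.
powers-1 : ∀ F → powers F (1+ 0) ≈ F
powers-1 F m = trans
  (cong (λ b → if b then coefficient F (root 1 m) else 0ℚ)
    (dec-true (isPower? 1 m) (All.universal (All.universal (λ e → 1∣ e)) m)))
  (coefficient-cong F _ _ (root-1 m))

-- Cauchy products of weighted families

-- Σ_{j ≤ n} F (k + j) ⊛ G (n − j), recursing on n as compositionsFrom does.
cauchy : (ℕ → Series) → (ℕ → Series) → ℕ → ℕ → Series
cauchy F G k zero    = F k ⊛ G 0
cauchy F G k (suc n) = (F k ⊛ G (suc n)) ⊕ cauchy F G (suc k) n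

-- The selection of degrees `p`, `q` made by `cauchy`: the value is 1 if `p + q = k + n` and
-- `k ≤ p`, and 0 otherwise. The recursion copies that of `cauchy`.
cauchyIndicator : ℕ → ℕ → ℕ → ℕ → ℚ
cauchyIndicator k zero    p q = indicator (p ≡ᵇ k) * indicator (q ≡ᵇ 0)
cauchyIndicator k (suc n) p q =
  indicator (p ≡ᵇ k) * indicator (q ≡ᵇ suc n) + cauchyIndicator (suc k) n p q

cauchyIndicator-suc-zero : ∀ k n q → cauchyIndicator (suc k) n 0 q ≡ 0ℚ
cauchyIndicator-suc-zero k zero    q = *-zeroˡ (indicator (q ≡ᵇ 0))
cauchyIndicator-suc-zero k (suc n) q =
  cong₂ _+_ (*-zeroˡ (indicator (q ≡ᵇ suc n))) (cauchyIndicator-suc-zero (suc k) n q)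

cauchyIndicator-suc-suc : ∀ k n p q →
  cauchyIndicator (suc k) n (suc p) q ≡ cauchyIndicator k n p q
cauchyIndicator-suc-suc k zero    p q = refl
cauchyIndicator-suc-suc k (suc n) p q =
  cong (indicator (p ≡ᵇ k) * indicator (q ≡ᵇ suc n) +_) (cauchyIndicator-suc-suc (suc k) n p q)

-- For `p = 0` only the first summand can be nonzero; for positive `p` that summand vanishes and the
-- remaining ones shift down by one.
cauchyIndicator-0 : ∀ n p q → cauchyIndicator 0 n p q ≡ indicator (p ℕ.+ q ≡ᵇ n)
cauchyIndicator-0 zero    p       q = sym (indicator-+-≡ᵇ0 p q)
cauchyIndicator-0 (suc n) zero    q =
  trans (cong₂ _+_ (*-identityˡ i) (cauchyIndicator-suc-zero 0 n q)) (+-identityʳ i)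
  where i = indicator (q ≡ᵇ suc n)
cauchyIndicator-0 (suc n) (suc p) q =
  trans (cong₂ _+_ (*-zeroˡ (indicator (q ≡ᵇ suc n))) (cauchyIndicator-suc-suc 0 n p q))
        (trans (+-identityˡ _) (cauchyIndicator-0 n p q))

HasWeight : (ℕ → ℚ) → (ℕ → Series) → Set
HasWeight w F = ∀ d m → coefficient (F d) m ≡ indicator (degree m ≡ᵇ d) * weight w m

module _ {f g : ℕ → ℚ} {F G : ℕ → Series}
         (F-weight : HasWeight f F) (G-weight : HasWeight g G) where

  coefficient-⊛-weight : ∀ k n m → coefficient (F k ⊛ G n) m ≡
    sumOver (λ (a , b) → (indicator (degree a ≡ᵇ k) * indicator (degree b ≡ᵇ n)) *
                         (weight f a * weight g b))
            (factorisations m)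
  coefficient-⊛-weight k n m = trans (coefficient-⊛ (F k) (G n) m)
    (sumOver-cong
      (λ (a , b) → trans (cong₂ _*_ (F-weight k a) (G-weight n b))
        (solve 4 (λ i y j z → (i :* y) :* (j :* z) := (i :* j) :* (y :* z)) refl
          (indicator (degree a ≡ᵇ k)) (weight f a) (indicator (degree b ≡ᵇ n)) (weight g b)))
      (factorisations m))

  -- All the products in `cauchy` are summed over the same factorisations of `m`, so their degree
  -- conditions can be added up term by term.
  coefficient-cauchy : ∀ k n m → coefficient (cauchy F G k n) m ≡
    sumOver (λ (a , b) → cauchyIndicator k n (degree a) (degree b) *
                         (weight f a * weight g b))
            (factorisations m)
  coefficient-cauchy k zero    m = coefficient-⊛-weight k 0 m
  coefficient-cauchy k (suc n) m = begin
    coefficient (F k ⊛ G (suc n)) m + coefficient (cauchy F G (suc k) n) m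
      ≡⟨ cong₂ _+_ (coefficient-⊛-weight k (suc n) m) (coefficient-cauchy (suc k) n m) ⟩
    _ ≡⟨ sumOver-+ _ _ (factorisations m) ⟨
    _ ≡⟨ sumOver-cong (λ (a , b) → sym (*-distribʳ-+ (weight f a * weight g b)
                        (indicator (degree a ≡ᵇ k) * indicator (degree b ≡ᵇ suc n))
                        (cauchyIndicator (suc k) n (degree a) (degree b))))
                      (factorisations m) ⟩
    _ ∎

  -- Over all pairs of degrees with sum `n`, the two separate conditions on the factors merge into
  -- one condition on the sum of their degrees, hence on `degree m`.
  cauchy-weight : HasWeight (f ⋆ g) (cauchy F G 0)
  cauchy-weight n m = begin
    coefficient (cauchy F G 0 n) m
      ≡⟨ coefficient-cauchy 0 n m ⟩
    _ ≡⟨ sumOver-cong (λ (a , b) → cong (_* (weight f a * weight g b))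
                                     (cauchyIndicator-0 n (degree a) (degree b)))
                      (factorisations m) ⟩
    _ ≡⟨ sumOver-factorisations f g n m ⟩
    indicator (degree m ≡ᵇ n) * weight (f ⋆ g) m ∎

  -- Since `f 0` is 1, the weight of `F 0` may be replaced by `δ₀`, which is neutral for `⋆`.
  ⊛-identityˡ-weight : f 0 ≡ 1ℚ → ∀ n → F 0 ⊛ G n ≈ G n
  ⊛-identityˡ-weight f0≡1 n m = begin
    coefficient (F 0 ⊛ G n) m
      ≡⟨ coefficient-⊛ (F 0) (G n) m ⟩
    _ ≡⟨ sumOver-cong (λ (a , b) → term a b) (factorisations m) ⟩
    _ ≡⟨ sumOver-factorisations δ₀ g n m ⟩
    indicator (degree m ≡ᵇ n) * weight (δ₀ ⋆ g) m
      ≡⟨ cong (indicator (degree m ≡ᵇ n) *_) (weight-cong (δ₀-⋆ g) m) ⟩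
    indicator (degree m ≡ᵇ n) * weight g m
      ≡⟨ G-weight n m ⟨
    coefficient (G n) m ∎
    where
    -- Once `p = 0` is imposed, `q = n` is the same as `p + q = n`, the form that
    -- `sumOver-factorisations` takes.
    shift : ∀ p q x → indicator (p ≡ᵇ 0) * (indicator (q ≡ᵇ n) * x) ≡
                      indicator (p ℕ.+ q ≡ᵇ n) * (indicator (p ≡ᵇ 0) * x)
    shift zero    q x = solve 2 (λ i x → con 1ℚ :* (i :* x) := i :* (con 1ℚ :* x)) refl
                          (indicator (q ≡ᵇ n)) x
    shift (suc p) q x = trans (*-zeroˡ (indicator (q ≡ᵇ n) * x))
      (sym (trans (cong (indicator (suc p ℕ.+ q ≡ᵇ n) *_) (*-zeroˡ x))
                  (*-zeroʳ (indicator (suc p ℕ.+ q ≡ᵇ n)))))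

    term : ∀ a b → coefficient (F 0) a * coefficient (G n) b ≡
                   indicator (degree a ℕ.+ degree b ≡ᵇ n) * (weight δ₀ a * weight g b)
    term a b = begin
      coefficient (F 0) a * coefficient (G n) b
        ≡⟨ cong₂ _*_ (trans (F-weight 0 a) (trans (weight-degree-0 {f} f0≡1 a) (weight-δ₀ a)))
                     (G-weight n b) ⟩
      indicator (degree a ≡ᵇ 0) * (indicator (degree b ≡ᵇ n) * weight g b)
        ≡⟨ shift (degree a) (degree b) (weight g b) ⟩
      indicator (degree a ℕ.+ degree b ≡ᵇ n) * (indicator (degree a ≡ᵇ 0) * weight g b)
        ≡⟨ cong (λ y → indicator (degree a ℕ.+ degree b ≡ᵇ n) * (y * weight g b))
                (weight-δ₀ a) ⟨
      indicator (degree a ℕ.+ degree b ≡ᵇ n) * (weight δ₀ a * weight g b) ∎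

-- The weight `δ₀` is supported on the monomial 1, which has degree 0.
δ₀-weight-suc : ∀ {F} → HasWeight δ₀ F → ∀ n → F (suc n) ≈ 𝟘
δ₀-weight-suc {F} F-weight n m = begin
  coefficient (F (suc n)) m
    ≡⟨ F-weight (suc n) m ⟩
  indicator (degree m ≡ᵇ suc n) * weight δ₀ m
    ≡⟨ cong (indicator (degree m ≡ᵇ suc n) *_) (weight-δ₀ m) ⟩
  indicator (degree m ≡ᵇ suc n) * indicator (degree m ≡ᵇ 0)
    ≡⟨ exclusive (degree m) ⟩
  0ℚ ∎
  where
  exclusive : ∀ p → indicator (p ≡ᵇ suc n) * indicator (p ≡ᵇ 0) ≡ 0ℚ
  exclusive zero    = refl
  exclusive (suc p) = *-zeroʳ (indicator (p ≡ᵇ n))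

-- Signed sums over compositions

signedTerm : (ℕ → Series) → Polycomposition → Series
signedTerm F δ = (-1^ ℓ δ) · (F ⟨ δ ⟩)

-- The argument is a list of compositions, so that the sum can follow the recursion of
-- `compositionsFrom`; at `compositions d` it unfolds to the sum over `PCom-sqf d`.
signedSum : (ℕ → Series) → List Composition → Series
signedSum F αs = ∑ (map (signedTerm F) (map _¹ αs))

signedSum-++ : ∀ F αs βs → signedSum F (αs ++ βs) ≈ signedSum F αs ⊕ signedSum F βs
signedSum-++ F []       βs m = sym (+-identityˡ _)
signedSum-++ F (α ∷ αs) βs m =
  trans (cong (coefficient (signedTerm F (α ¹)) m +_) (signedSum-++ F αs βs m))
        (sym (+-assoc (coefficient (signedTerm F (α ¹)) m) _ _))

-- One more part adds 1 to the length, whence the sign, and adds one block of multiplicity 1, whence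
-- the factor.
signedTerm-∷ : ∀ F k α → signedTerm F ((1+ k ∷ α) ¹) ≈ (- 1ℚ) · (F (suc k) ⊛ signedTerm F (α ¹))
signedTerm-∷ F k α m = begin
  ((- 1ℚ) * s) * coefficient (powers (F (suc k)) (1+ 0) ⊛ F ⟨ α ¹ ⟩) m
    ≡⟨ cong (((- 1ℚ) * s) *_)
         (⊛-cong (powers (F (suc k)) (1+ 0)) (F (suc k)) (F ⟨ α ¹ ⟩) (F ⟨ α ¹ ⟩)
                 (powers-1 (F (suc k))) (λ _ → refl) m) ⟩
  ((- 1ℚ) * s) * coefficient (F (suc k) ⊛ F ⟨ α ¹ ⟩) m
    ≡⟨ *-assoc (- 1ℚ) s _ ⟩
  (- 1ℚ) * (s * coefficient (F (suc k) ⊛ F ⟨ α ¹ ⟩) m)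
    ≡⟨ cong ((- 1ℚ) *_) (⊛-· s (F (suc k)) (F ⟨ α ¹ ⟩) m) ⟨
  (- 1ℚ) * coefficient (F (suc k) ⊛ signedTerm F (α ¹)) m ∎
  where s = -1^ ℓ (α ¹)

signedSum-∷ : ∀ F k αs →
  signedSum F (map (1+ k ∷_) αs) ≈ (- 1ℚ) · (F (suc k) ⊛ signedSum F αs)
signedSum-∷ F k []       m = sym (cong ((- 1ℚ) *_) (⊛-zeroʳ (F (suc k)) m))
signedSum-∷ F k (α ∷ αs) m = begin
  coefficient (signedTerm F ((1+ k ∷ α) ¹)) m + coefficient (signedSum F (map (1+ k ∷_) αs)) m
    ≡⟨ cong₂ _+_ (signedTerm-∷ F k α m) (signedSum-∷ F k αs m) ⟩
  (- 1ℚ) * coefficient (F (suc k) ⊛ signedTerm F (α ¹)) m +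
  (- 1ℚ) * coefficient (F (suc k) ⊛ signedSum F αs) m
    ≡⟨ *-distribˡ-+ (- 1ℚ) (coefficient (F (suc k) ⊛ signedTerm F (α ¹)) m)
                           (coefficient (F (suc k) ⊛ signedSum F αs) m) ⟨
  (- 1ℚ) * (coefficient (F (suc k) ⊛ signedTerm F (α ¹)) m +
            coefficient (F (suc k) ⊛ signedSum F αs) m)
    ≡⟨ cong ((- 1ℚ) *_) (⊛-distribˡ-⊕ (F (suc k)) (signedTerm F (α ¹)) (signedSum F αs) m) ⟨
  (- 1ℚ) * coefficient (F (suc k) ⊛ signedSum F (α ∷ αs)) m ∎

-- Grouping by the first part `suc k + j` leaves a composition of `n − j`, and the signed sum over
-- these is `G (n − j)` by hypothesis.
signedSum-compositionsFrom : ∀ F G k n →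
  (∀ j → j ≤ n → signedSum F (compositions j) ≈ G j) →
  signedSum F (compositionsFrom k n) ≈ (- 1ℚ) · cauchy F G (suc k) n
signedSum-compositionsFrom F G k zero IH m = trans
  (signedSum-∷ F k (compositions 0) m)
  (cong ((- 1ℚ) *_)
    (⊛-cong (F (suc k)) (F (suc k)) (signedSum F (compositions 0)) (G 0)
            (λ _ → refl) (IH 0 z≤n) m))
signedSum-compositionsFrom F G k (suc n) IH m = begin
  -- The tails listed by `compositionsFrom 0 n` are by definition `compositions (suc n)`, so the
  -- hypothesis applies to them.
  coefficient (signedSum F (map (1+ k ∷_) (compositions (suc n)) ++ compositionsFrom (suc k) n)) m
    ≡⟨ signedSum-++ F (map (1+ k ∷_) (compositions (suc n))) (compositionsFrom (suc k) n) m ⟩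
  _ ≡⟨ cong₂ _+_
         (trans (signedSum-∷ F k (compositions (suc n)) m)
           (cong ((- 1ℚ) *_)
             (⊛-cong (F (suc k)) (F (suc k)) (signedSum F (compositions (suc n))) (G (suc n))
                     (λ _ → refl) (IH (suc n) ℕ.≤-refl) m)))
         (signedSum-compositionsFrom F G (suc k) n (λ j j≤n → IH j (ℕ.m≤n⇒m≤1+n j≤n)) m) ⟩
  (- 1ℚ) * coefficient (F (suc k) ⊛ G (suc n)) m +
  (- 1ℚ) * coefficient (cauchy F G (suc (suc k)) n) m
    ≡⟨ *-distribˡ-+ (- 1ℚ) (coefficient (F (suc k) ⊛ G (suc n)) m)
                           (coefficient (cauchy F G (suc (suc k)) n) m) ⟨
  (- 1ℚ) * coefficient (cauchy F G (suc k) (suc n)) m ∎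

module _ (f g : ℕ → ℚ) {F G : ℕ → Series}
         (F-weight : HasWeight f F) (G-weight : HasWeight g G)
         (f0≡1 : f 0 ≡ 1ℚ) (g0≡1 : g 0 ≡ 1ℚ) (f⋆g≡δ₀ : ∀ e → (f ⋆ g) e ≡ δ₀ e) where

  cauchy-suc : ∀ n → cauchy F G 0 (suc n) ≈ 𝟘
  cauchy-suc = δ₀-weight-suc {cauchy F G 0} λ d m → trans
    (cauchy-weight {f} {g} {F} {G} F-weight G-weight d m)
    (cong (indicator (degree m ≡ᵇ d) *_) (weight-cong f⋆g≡δ₀ m))

  -- The bound `n` makes the strong induction structural: the case `suc j` uses all `i ≤ j`.
  signedSum-compositions-≤ : ∀ n j → j ≤ n → signedSum F (compositions j) ≈ G j
  signedSum-compositions-≤ n zero z≤n m = begin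
    1ℚ * coefficient 𝟙 m + 0ℚ              ≡⟨ trans (+-identityʳ _) (*-identityˡ _) ⟩
    indicator (degree m ≡ᵇ 0)              ≡⟨ weight-δ₀ m ⟨
    weight δ₀ m                            ≡⟨ weight-degree-0 {g} g0≡1 m ⟨
    indicator (degree m ≡ᵇ 0) * weight g m ≡⟨ G-weight 0 m ⟨
    coefficient (G 0) m                    ∎
  signedSum-compositions-≤ (suc n) (suc j) (s≤s j≤n) m = begin
    coefficient (signedSum F (compositionsFrom 0 j)) m
      ≡⟨ signedSum-compositionsFrom F G 0 j
           (λ i i≤j → signedSum-compositions-≤ n i (ℕ.≤-trans i≤j j≤n)) m ⟩
    (- 1ℚ) * c
      -- Here `c` lacks only the term `x` with `F 0` of the full Cauchy sum, so `x + c` is that sum,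
      -- which vanishes, while `x` is the desired coefficient of `G (suc j)`.
      ≡⟨ solve 2 (λ x c → con (- 1ℚ) :* c := x :+ :- (x :+ c)) refl x c ⟩
    x + - (x + c)
      ≡⟨ cong₂ (λ y z → y + - z)
           (⊛-identityˡ-weight {f} {g} {F} {G} F-weight G-weight f0≡1 (suc j) m)
           (cauchy-suc j m) ⟩
    coefficient (G (suc j)) m + - 0ℚ
      ≡⟨ +-identityʳ _ ⟩
    coefficient (G (suc j)) m ∎
    where
    x = coefficient (F 0 ⊛ G (suc j)) m
    c = coefficient (cauchy F G 1 j) m

  signedSum-compositions : ∀ d → G d ≈ signedSum F (compositions d)
  signedSum-compositions d m = sym (signedSum-compositions-≤ d d ℕ.≤-refl m)

-- The weights of `H` and `E` and their inversion

H-weight : HasWeight (λ _ → 1ℚ) H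
H-weight d m = sym (trans (cong (indicator (degree m ≡ᵇ d) *_) (weight-1 m))
                          (*-identityʳ (indicator (degree m ≡ᵇ d))))

-- The coefficients of 1 - x, written in the form of the sign in `E` so that `all?-sign` applies.
μ : ℕ → ℚ
μ e = if does (e ℕ.≤? 1) then -1^ (e ⊓ 1) else 0ℚ

-- The sign of a total is the product of the signs, and a single failing entry makes both sides 0.
-- It serves for rows and again for the exponents in a row.
all?-sign : {P : A → Set} (P? : Decidable P) (k : A → ℕ) → ∀ xs →
  (if does (all? P? xs) then -1^ total (λ _ → k) xs else 0ℚ) ≡
  productOver (λ x → if does (P? x) then -1^ k x else 0ℚ) xs
all?-sign P? k []       = refl
all?-sign P? k (x ∷ xs) with does (P? x)
... | false = sym (*-zeroˡ (productOver (λ y → if does (P? y) then -1^ k y else 0ℚ) xs))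
... | true  with does (all? P? xs) | all?-sign P? k xs
...   | false | eq = trans (sym (*-zeroʳ (-1^ k x))) (cong ((-1^ k x) *_) eq)
...   | true  | eq = trans
  (^-homo-* (CommutativeRing.semiring +-*-commutativeRing) (- 1ℚ) (k x) (total (λ _ → k) xs))
  (cong ((-1^ k x) *_) eq)

E-weight : HasWeight μ E
E-weight d m with degree m ≡ᵇ d
... | false = sym (*-zeroˡ (weight μ m))
... | true  = trans (all?-sign (all? (ℕ._≤? 1)) (total (λ _ e → e ⊓ 1)) m)
  (trans (productOver-cong (all?-sign (ℕ._≤? 1) (_⊓ 1)) m) (sym (*-identityˡ _)))

-- This is (1 - x)(1 + x + x² + ⋯) = 1: for a positive exponent only the first two terms of the sum
-- are nonzero, and they cancel.
μ⋆1 : ∀ e → (μ ⋆ λ _ → 1ℚ) e ≡ δ₀ e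
μ⋆1 zero    = refl
μ⋆1 (suc e) = trans (⋆-applyUpTo μ (λ _ → 1ℚ) (suc e))
  (cong (λ s → 1ℚ + (- 1ℚ + s)) (sumℚ-applyUpTo-0 (λ _ → refl) e))

-- Now the nonzero terms stand at the end of the sum, so the first term is peeled off and the rest
-- is the same convolution at `e`.
1⋆μ : ∀ e → ((λ _ → 1ℚ) ⋆ μ) e ≡ δ₀ e
1⋆μ zero    = refl
1⋆μ (suc e) = begin
  ((λ _ → 1ℚ) ⋆ μ) (suc e)
    ≡⟨ ⋆-applyUpTo (λ _ → 1ℚ) μ (suc e) ⟩
  1ℚ * μ (suc e) + sumℚ (applyUpTo (λ a → 1ℚ * μ (e ∸ a)) (suc e))
    ≡⟨ cong (1ℚ * μ (suc e) +_) (⋆-applyUpTo (λ _ → 1ℚ) μ e) ⟨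
  1ℚ * μ (suc e) + ((λ _ → 1ℚ) ⋆ μ) e
    ≡⟨ cong (1ℚ * μ (suc e) +_) (1⋆μ e) ⟩
  1ℚ * μ (suc e) + δ₀ e
    ≡⟨ cancel e ⟩
  0ℚ ∎
  where
  cancel : ∀ e → 1ℚ * μ (suc e) + δ₀ e ≡ 0ℚ
  cancel zero    = refl
  cancel (suc e) = refl

proposition11 : (d : ℕ) →
    (H d ≈ ∑ (map (λ δ → (-1^ ℓ δ) · (E ⟨ δ ⟩)) (PCom-sqf d))) ×
    (E d ≈ ∑ (map (λ δ → (-1^ ℓ δ) · (H ⟨ δ ⟩)) (PCom-sqf d)))
proposition11 d =
  signedSum-compositions μ (λ _ → 1ℚ) {E} {H} E-weight H-weight refl refl μ⋆1 d ,
  signedSum-compositions (λ _ → 1ℚ) μ {H} {E} H-weight E-weight refl refl 1⋆μ d
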